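{- For every integer $n\ge 0$, \[ d_{n,q}=\begin{cases} 1, & n=0,\\[4pt] \displaystyle\frac{[2]_q}{2}\frac{(-4)^n}{n!}D_{n,q}(0|1)-q\sum_{m=0}^{n-1}\frac{(-4)^{n-m-1}}{(n-m-1)!}D_{n-m-1,q}(0|1)\,C_m, & n\ge 1.\end{cases} \]
   Context: Let $p$ be a fixed odd prime, $\mathbb{C}_p$ the completion of the algebraic closure of $\mathbb{Q}_p$, with $|p|_p=1/p$. Let $q\in\mathbb{C}_p$ with $|1-q|_p<p^{ -1/(p-1)}$, and $\log$ denotes the $p$-adic logarithm. Put $[x]_q=\frac{1-q^x}{1-q}$, so $[2]_q=1+q$. $C_m=\frac{1}{m+1}\binom{2m}{m}$ is the $m$-th Catalan number. The numbers $D_{n,q}(0|1)$ are defined by \[ \frac{2(q-1)+\frac{q-1}{\log q}\log(1+t)}{q^{2}(1+t)-1}=\sum_{n=0}^{\infty}D_{n,q}(0|1)\frac{t^n}{n!}. \] The $q$-analogues of the Catalan–Daehee numbers $d_{n,q}$ are defined by \[ \frac{q-1+\frac{q-1}{\log q}\cdot\frac12\log(1-4t)}{q\sqrt{1-4t}-1}=\sum_{n=0}^{\infty}d_{n,q}t^n, \] for $t\in\mathbb{C}_p$ with $|t|_p<p^{ -1/(p-1)}$ (equivalently as power series in $t$). -}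

module Defs where

open import Algebra.Bundles using (CommutativeRing; Semiring)
import Algebra.Definitions.RawSemiring as RawSemiringDefs
open import Data.Fin.Base using (Fin; toℕ)
open import Data.Integer.Base as ℤ using (ℤ; +_; -[1+_])
open import Data.Nat.Base as ℕ using (ℕ; zero; suc; _∸_; _!; NonZero)
open import Data.Nat.Combinatorics using (_C_)
open import Data.Nat.Primality using (Prime; prime⇒nonTrivial)
open import Data.Nat.Properties using (m>n⇒m∸n≢0)
open import Data.Product.Base using (_×_; ∃; ∃-syntax)
open import Data.Rational.Base as ℚ using (ℚ; ↥_; ↧ₙ_; 1ℚ)
open import Data.Vec.Functional using (Vector)
open import Level using (Level; _⊔_) renaming (suc to lsuc)
open import Relation.Binary.Construct.Add.Supremum.NonStrict ℚ._≤_ public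
  using (_≤⁺_)
open import Relation.Binary.Construct.Add.Supremum.Strict ℚ._<_ public
  using (_<⁺_)
open import Relation.Binary.PropositionalEquality.Core using (_≡_)
open import Relation.Nullary.Construct.Add.Supremum public
  using (_⁺; [_]; ⊤⁺)
open import Relation.Nullary.Negation.Core using (¬_)

private
  variable
    c ℓ : Level

-- The inverse is a total operation whose value at 0# is unconstrained.
record Field c ℓ : Set (lsuc (c ⊔ ℓ)) where
  field
    commutativeRing : CommutativeRing c ℓ

  open CommutativeRing commutativeRing public

  infix 9 _⁻¹

  field
    _⁻¹      : Carrier → Carrier
    ⁻¹-cong  : ∀ {x y} → x ≈ y → x ⁻¹ ≈ y ⁻¹
    inverseʳ : ∀ {x} → ¬ (x ≈ 0#) → x * x ⁻¹ ≈ 1#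
    1≉0      : ¬ (1# ≈ 0#)

  open RawSemiringDefs (Semiring.rawSemiring semiring) public
    using (sum; _^_)
    renaming (_×_ to _·_)

  infixl 7 _/_

  _/_ : Carrier → Carrier → Carrier
  x / y = x * y ⁻¹

  fromℕ : ℕ → Carrier
  fromℕ n = n · 1#

  fromℤ : ℤ → Carrier
  fromℤ (+ n)    = fromℕ n
  fromℤ -[1+ n ] = - fromℕ (suc n)

  fromℚ : ℚ → Carrier
  fromℚ r = fromℤ (↥ r) / fromℕ (↧ₙ r)

  -- ∑< n f = f 0 + ⋯ + f (n - 1)
  ∑< : ℕ → (ℕ → Carrier) → Carrier
  ∑< n f = sum {n} (λ i → f (toℕ i))

  -- x ^ n + a (n - 1) * x ^ (n - 1) + ⋯ + a 0
  monic : ∀ {n} → Vector Carrier n → Carrier → Carrier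
  monic {n} a x = x ^ n + sum (λ i → a i * x ^ toℕ i)

infixl 6 _+⁺_

_+⁺_ : ℚ ⁺ → ℚ ⁺ → ℚ ⁺
[ r ] +⁺ [ s ] = [ r ℚ.+ s ]
[ _ ] +⁺ ⊤⁺    = ⊤⁺
⊤⁺    +⁺ _     = ⊤⁺

-- The field ℂₚ, characterised as the completion of an algebraic closure of
-- ℚₚ.  The absolute value is ∣ x ∣ₚ = p ^ (- v x), with ∣ 0 ∣ₚ = 0 encoded as
-- v 0# = ⊤⁺; a rational-valued v suffices because ∣ ℂₚ^× ∣ₚ = p ^ ℚ.
record ComplexPadic (p : ℕ) c ℓ : Set (lsuc (c ⊔ ℓ)) where
  field
    fld : Field c ℓ

  open Field fld public

  field
    v             : Carrier → ℚ ⁺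
    v-cong        : ∀ {x y} → x ≈ y → v x ≡ v y
    v-0           : v 0# ≡ ⊤⁺
    v-⊤           : ∀ {x} → v x ≡ ⊤⁺ → x ≈ 0#
    v-*           : ∀ x y → v (x * y) ≡ v x +⁺ v y
    v-ultrametric : ∀ {r} x y → r ≤⁺ v x → r ≤⁺ v y → r ≤⁺ v (x + y)
    v-p           : v (fromℕ p) ≡ [ 1ℚ ]
    charZero      : ∀ n → ¬ (fromℕ (suc n) ≈ 0#)

  Cauchy : (ℕ → Carrier) → Set
  Cauchy s = ∀ (r : ℚ) → ∃[ N ] ∀ m n → N ℕ.≤ m → N ℕ.≤ n →
    [ r ] ≤⁺ v (s m - s n)

  _ConvergesTo_ : (ℕ → Carrier) → Carrier → Set
  s ConvergesTo x = ∀ (r : ℚ) → ∃[ N ] ∀ n → N ℕ.≤ n → [ r ] ≤⁺ v (s n - x)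

  -- ℚₚ as the closure of ℚ.
  Inℚₚ : Carrier → Set
  Inℚₚ x = ∀ (r : ℚ) → ∃[ a ] [ r ] ≤⁺ v (x - fromℚ a)

  Algebraic : Carrier → Set (c ⊔ ℓ)
  Algebraic x = ∃[ n ] ∃ λ (a : Vector Carrier (suc n)) →
    (∀ i → Inℚₚ (a i)) × monic a x ≈ 0#

  field
    complete            : ∀ s → Cauchy s → ∃ λ x → s ConvergesTo x
    algebraicallyClosed : ∀ n (a : Vector Carrier (suc n)) →
                          ∃ λ x → monic a x ≈ 0#
    algebraicDense      : ∀ x (r : ℚ) →
                          ∃ λ y → Algebraic y × [ r ] ≤⁺ v (x - y)

  -- ∣ x ∣ₚ < p ^ (- r)
  ∣_∣<p^-_ : Carrier → ℚ → Set
  ∣ x ∣<p^- r = [ r ] <⁺ v x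

1/[_-1] : ∀ {p} → Prime p → ℚ
1/[_-1] {p} pp = + 1 ℚ./ (p ∸ 1)
  where
  instance
    p-1≢0 : NonZero (p ∸ 1)
    p-1≢0 = ℕ.≢-nonZero
      (m>n⇒m∸n≢0 (ℕ.nonTrivial⇒n>1 p {{prime⇒nonTrivial pp}}))

module PowerSeries (K : Field c ℓ) where
  open Field K

  Series : Set c
  Series = ℕ → Carrier

  infixl 6 _+ₛ_ _-ₛ_
  infixl 7 _*ₛ_ _·ₛ_ _/ₛ_
  infixr 8 _^ₛ_

  const : Carrier → Series
  const a zero    = a
  const a (suc _) = 0#

  t : Series
  t zero          = 0#
  t (suc zero)    = 1#
  t (suc (suc _)) = 0#

  _+ₛ_ _-ₛ_ _*ₛ_ : Series → Series → Series
  (f +ₛ g) n = f n + g n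
  (f -ₛ g) n = f n - g n
  (f *ₛ g) n = ∑< (suc n) (λ k → f k * g (n ∸ k))

  _·ₛ_ : Carrier → Series → Series
  (a ·ₛ f) n = a * f n

  _^ₛ_ : Series → ℕ → Series
  f ^ₛ zero  = const 1#
  f ^ₛ suc k = f *ₛ f ^ₛ k

  -- Substitution ∑ₖ a k * u ^ k for a series u with u 0 ≈ 0#, in which case
  -- the terms with k > n do not contribute to the coefficient of t ^ n.
  _⟨_⟩ : Series → Series → Series
  (a ⟨ u ⟩) n = ∑< (suc n) (λ k → a k * (u ^ₛ k) n)

  geometric : Series
  geometric _ = 1#

  logarithmic : Series
  logarithmic zero    = 0#
  logarithmic (suc k) = (- 1#) ^ k / fromℕ (suc k)

  -- Generalised binomial coefficients a (a - 1) ⋯ (a - k + 1) / k !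
  binomial : Carrier → Series
  binomial a zero    = 1#
  binomial a (suc k) = binomial a k * (a - fromℕ k) / fromℕ (suc k)

  -- f * (1 / f 0) = 1 - u, so 1 / f = (1 / f 0) * ∑ₖ u ^ k, when f 0 is nonzero.
  _⁻¹ₛ : Series → Series
  f ⁻¹ₛ = (f 0) ⁻¹ ·ₛ (geometric ⟨ const 1# -ₛ (f 0) ⁻¹ ·ₛ f ⟩)

  _/ₛ_ : Series → Series → Series
  f /ₛ g = f *ₛ g ⁻¹ₛ

  -- log (1 + u) and √ (1 + u), for u 0 ≈ 0#.
  log1+ √1+ : Series → Series
  log1+ u = logarithmic ⟨ u ⟩
  √1+   u = binomial (1# / fromℕ 2) ⟨ u ⟩

module CatalanDaehee {p : ℕ} (ℂₚ : ComplexPadic p c ℓ) where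
  open ComplexPadic ℂₚ
  open PowerSeries fld

  -- L is the p-adic logarithm of x.
  IsLog : Carrier → Carrier → Set
  IsLog x L =
    (λ n → ∑< n (λ k → logarithmic k * (x - 1#) ^ k)) ConvergesTo L

  [_]⟨_⟩ : ℕ → Carrier → Carrier
  [ m ]⟨ q ⟩ = (1# - q ^ m) / (1# - q)

  catalan : ℕ → Carrier
  catalan m = 1# / fromℕ (suc m) * fromℕ ((2 ℕ.* m) C m)

  -4t : Series
  -4t = (- fromℕ 4) ·ₛ t

  -- In D and d the argument logq stands for log q.
  D : (q logq : Carrier) → ℕ → Carrier
  D q logq n = fromℕ (n !) * (numerator /ₛ denominator) n
    where
    numerator denominator : Series
    numerator   = const (fromℕ 2 * (q - 1#)) +ₛ ((q - 1#) / logq) ·ₛ log1+ t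
    denominator = q ^ 2 ·ₛ (const 1# +ₛ t) -ₛ const 1#

  d : (q logq : Carrier) → ℕ → Carrier
  d q logq = numerator /ₛ denominator
    where
    numerator denominator : Series
    numerator   = const (q - 1#) +ₛ
                  ((q - 1#) / logq * (1# / fromℕ 2)) ·ₛ log1+ -4t
    denominator = q ·ₛ √1+ -4t -ₛ const 1#

{-# OPTIONS --safe #-}

-- Write s = √(1 - 4t) and F = ∑ D_n t ^ n / n !.  Substituting t ↦ -4t in F
-- gives twice the numerator of d over the denominator q² s² - 1 =
-- (q s - 1) (q s + 1), hence 2 d = (q s + 1) F(-4t).  The formula is
-- read off the coefficients, since s = 1 - 2t ∑ C_m t ^ m.  The denominators are
-- invertible because q ≠ 1, and because q = -1 would make 2 = 1 - q a non-unit
-- in the p-adic integers although p is odd.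

module Submission where

open import Algebra.Bundles using (CommutativeRing)
import Algebra.Properties.CommutativeMonoid.Sum as Sum
import Algebra.Properties.CommutativeSemigroup as CommutativeSemigroupProperties
import Algebra.Properties.Group as GroupProperties
import Algebra.Properties.Monoid.Mult as MonoidMult
import Algebra.Properties.Ring as RingProperties
import Algebra.Properties.Semiring.Mult as SemiringMult
import Algebra.Solver.Ring.NaturalCoefficients.Default as SemiringSolver
open import Data.Nat.Base as ℕ using (ℕ; zero; suc; _∸_; _!)
open import Data.Fin.Base using (toℕ)
import Data.Nat.Properties as ℕ
open import Data.Nat.Combinatorics using (_C_; nCk≡n!/k![n-k]!; k![n∸k]!∣n!)
open import Data.Nat.DivMod using (m/n*n≡m; m%n<n; m≡m%n+[m/n]*n)
open import Data.Nat.Solver using (module +-*-Solver)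
open import Data.Nat.Divisibility using (_∣_; m%n≡0⇒n∣m)
open import Data.Nat.Primality using (Prime; prime⇒nonTrivial)
open import Data.Product.Base using (_×_; _,_; ∃)
open import Data.Rational.Base as ℚ using (ℚ; 0ℚ; 1ℚ)
import Data.Rational.Properties as ℚ
open import Data.Sum.Base using (inj₁; inj₂)
import Relation.Binary.Reasoning.Setoid as SetoidReasoning
open import Relation.Binary.PropositionalEquality.Core as ≡ using (_≡_)
open import Relation.Binary.PropositionalEquality.Properties using (module ≡-Reasoning)
open import Relation.Binary.Construct.Add.Supremum.NonStrict ℚ._≤_ using ([_]; _≤⊤⁺; ≤⁺-trans)
open import Relation.Binary.Construct.Add.Supremum.Strict ℚ._<_ using ([_])
open import Relation.Nullary.Construct.Add.Supremum using ([_]; []-injective)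
open import Relation.Nullary.Negation.Core using (¬_; contradiction)
open import Defs

-- The obstacle is `_⟨_⟩`: its coefficient n is cut off after n + 1 terms, so the cut moves with n
-- and compatibility with products is hidden. Everything about it is drawn from the Horner identity
-- a(u) = a₀ + u · b(u), where b is the sequence a shifted by one. For u a multiple of t this
-- identity turns substitution into a rescaling of coefficients by powers, and rescaling visibly
-- respects products. The square of √(1 - 4t) is therefore found before substituting, from a
-- differential equation for `binomial 1/2`. The same equation brings in the Catalan numbers: it
-- gives the coefficients of √(1 - 4t) a first-order recurrence, which is the one that central
-- binomial coefficients yield for C_m. Quotients are handled by multiplying out their denominators.

module _ {c ℓ} (R : CommutativeRing c ℓ) where
  open CommutativeRing R
  open SemiringSolver commutativeSemiring
  open SetoidReasoning setoid

  -- Stated for an arbitrary commutative ring because it serves twice: for q in the field, and for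
  -- the series q √(1 - 4t) in the ring of power series.
  [x-1][x+1]≈x²-1 : ∀ x → (x - 1#) * (x + 1#) ≈ x * x - 1#
  [x-1][x+1]≈x²-1 x = begin
    (x - 1#) * (x + 1#)
      -- The solver knows semirings only, so -1 enters as an opaque variable y and the leftover y +
      -- 1 is cancelled by hand. Negatives are treated in this way throughout.
      ≈⟨ solve 2 (λ x y → (x :+ y) :* (x :+ con 1) := x :* x :+ y :+ (y :+ con 1) :* x) refl
           x (- 1#) ⟩
    x * x - 1# + (- 1# + 1#) * x
      ≈⟨ +-congˡ (trans (*-congʳ (-‿inverseˡ 1#)) (zeroˡ x)) ⟩
    x * x - 1# + 0#
      ≈⟨ +-identityʳ _ ⟩
    x * x - 1# ∎

-- Cancellation and numerals in a field

module FieldProperties {c ℓ} (K : Field c ℓ) where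
  open Field K
  open SemiringSolver commutativeSemiring
  open SetoidReasoning setoid

  *-cancelˡ : ∀ {x y z} → ¬ (x ≈ 0#) → x * y ≈ x * z → y ≈ z
  *-cancelˡ {x} {y} {z} x≉0 xy≈xz = begin
    y              ≈⟨ unit y ⟨
    x ⁻¹ * (x * y) ≈⟨ *-congˡ xy≈xz ⟩
    x ⁻¹ * (x * z) ≈⟨ unit z ⟩
    z              ∎
    where
    unit : ∀ w → x ⁻¹ * (x * w) ≈ w
    unit w = begin
      x ⁻¹ * (x * w) ≈⟨ solve 3 (λ x x' w → x' :* (x :* w) := (x :* x') :* w) refl x (x ⁻¹) w ⟩
      x * x ⁻¹ * w   ≈⟨ *-congʳ (inverseʳ x≉0) ⟩
      1# * w         ≈⟨ *-identityˡ w ⟩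
      w              ∎

  *-nonZero : ∀ {x y} → ¬ (x ≈ 0#) → ¬ (y ≈ 0#) → ¬ (x * y ≈ 0#)
  *-nonZero x≉0 y≉0 xy≈0 = y≉0 (*-cancelˡ x≉0 (trans xy≈0 (sym (zeroʳ _))))

  x*[y/x]≈y : ∀ {x y} → ¬ (x ≈ 0#) → x * (y / x) ≈ y
  x*[y/x]≈y {x} {y} x≉0 = begin
    x * (y * x ⁻¹) ≈⟨ solve 3 (λ x y x' → x :* (y :* x') := y :* (x :* x')) refl x y (x ⁻¹) ⟩
    y * (x * x ⁻¹) ≈⟨ *-congˡ (inverseʳ x≉0) ⟩
    y * 1#         ≈⟨ *-identityʳ y ⟩
    y              ∎

  fromℕ-+ : ∀ m n → fromℕ (m ℕ.+ n) ≈ fromℕ m + fromℕ n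
  fromℕ-+ = MonoidMult.×-homo-+ +-monoid 1#

  fromℕ-* : ∀ m n → fromℕ (m ℕ.* n) ≈ fromℕ m * fromℕ n
  fromℕ-* = SemiringMult.×1-homo-* semiring

  1^n≈1 : ∀ n → 1# ^ n ≈ 1#
  1^n≈1 zero    = refl
  1^n≈1 (suc n) = trans (*-identityˡ _) (1^n≈1 n)

-- The commutative ring of formal power series

module SeriesProperties {c ℓ} (K : Field c ℓ) where
  open Field K
  open PowerSeries K
  open FieldProperties K
  open SemiringSolver commutativeSemiring
  open SetoidReasoning setoid
  open Sum +-commutativeMonoid using (sum-cong-≋)

  infix 4 _≈ₛ_

  -- A record rather than a function type, so that both series can be inferred.
  record _≈ₛ_ (f g : Series) : Set ℓ where
    constructor coefficients
    field coefficient : ∀ n → f n ≈ g n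

  open _≈ₛ_ public

  tail : Series → Series
  tail f n = f (suc n)

  infix 8 -ₛ_

  -ₛ_ : Series → Series
  (-ₛ f) n = - f n

  +ₛ-cong : ∀ {f f′ g g′} → f ≈ₛ f′ → g ≈ₛ g′ → f +ₛ g ≈ₛ f′ +ₛ g′
  +ₛ-cong p r .coefficient n = +-cong (p .coefficient n) (r .coefficient n)

  *ₛ-cong : ∀ {f f′ g g′} → f ≈ₛ f′ → g ≈ₛ g′ → f *ₛ g ≈ₛ f′ *ₛ g′
  *ₛ-cong p r .coefficient n =
    sum-cong-≋ {suc n} λ i → *-cong (p .coefficient (toℕ i)) (r .coefficient (n ∸ toℕ i))

  -- Needed because truncated substitutions agree only up to a given degree. The induction is the
  -- pattern for the products below: coefficient `suc n` of `f *ₛ g` unfolds by computation to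
  -- `f 0 * g (suc n) + (tail f *ₛ g) n`, so f is replaced by its tail while n drops by one.
  *ₛ-congˡ-≤ : ∀ f {g h} n → (∀ j → j ℕ.≤ n → g j ≈ h j) → (f *ₛ g) n ≈ (f *ₛ h) n
  *ₛ-congˡ-≤ f zero    g≈h = +-congʳ (*-congˡ (g≈h 0 ℕ.z≤n))
  *ₛ-congˡ-≤ f (suc n) g≈h =
    +-cong (*-congˡ (g≈h (suc n) ℕ.≤-refl))
           (*ₛ-congˡ-≤ (tail f) n λ j j≤n → g≈h j (ℕ.m≤n⇒m≤1+n j≤n))

  ·ₛ-*ₛ : ∀ a f g n → ((a ·ₛ f) *ₛ g) n ≈ a * (f *ₛ g) n
  ·ₛ-*ₛ a f g zero    =
    solve 3 (λ a x y → a :* x :* y :+ con 0 := a :* (x :* y :+ con 0)) refl a (f 0) (g 0)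
  ·ₛ-*ₛ a f g (suc n) = begin
    a * f 0 * g (suc n) + ((a ·ₛ tail f) *ₛ g) n ≈⟨ +-congˡ (·ₛ-*ₛ a (tail f) g n) ⟩
    a * f 0 * g (suc n) + a * (tail f *ₛ g) n
      ≈⟨ solve 4 (λ a x y z → a :* x :* y :+ a :* z := a :* (x :* y :+ z)) refl a (f 0) (g (suc n)) _ ⟩
    a * (f 0 * g (suc n) + (tail f *ₛ g) n)      ∎

  *ₛ-distribʳ : ∀ h f g n → ((f +ₛ g) *ₛ h) n ≈ (f *ₛ h) n + (g *ₛ h) n
  *ₛ-distribʳ h f g zero    =
    solve 3 (λ x y z → (x :+ y) :* z :+ con 0 := x :* z :+ con 0 :+ (y :* z :+ con 0)) refl
      (f 0) (g 0) (h 0)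
  *ₛ-distribʳ h f g (suc n) = begin
    (f 0 + g 0) * h (suc n) + ((tail f +ₛ tail g) *ₛ h) n
      ≈⟨ +-congˡ (*ₛ-distribʳ h (tail f) (tail g) n) ⟩
    (f 0 + g 0) * h (suc n) + ((tail f *ₛ h) n + (tail g *ₛ h) n)
      ≈⟨ solve 5 (λ x y z u v → (x :+ y) :* z :+ (u :+ v) := x :* z :+ u :+ (y :* z :+ v)) refl
           (f 0) (g 0) (h (suc n)) _ _ ⟩
    f 0 * h (suc n) + (tail f *ₛ h) n + (g 0 * h (suc n) + (tail g *ₛ h) n) ∎

  -- Works because the tail of `f *ₛ g` is, by computation, `f 0 ·ₛ tail g +ₛ tail f *ₛ g`, to which
  -- distributivity and the induction hypothesis apply.
  *ₛ-assoc : ∀ f g h n → ((f *ₛ g) *ₛ h) n ≈ (f *ₛ (g *ₛ h)) n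
  *ₛ-assoc f g h zero    =
    solve 3 (λ x y z → (x :* y :+ con 0) :* z :+ con 0 := x :* (y :* z :+ con 0) :+ con 0) refl
      (f 0) (g 0) (h 0)
  *ₛ-assoc f g h (suc n) = begin
    (f 0 * g 0 + 0#) * h (suc n) + ((f 0 ·ₛ tail g +ₛ tail f *ₛ g) *ₛ h) n
      ≈⟨ +-congˡ (*ₛ-distribʳ h (f 0 ·ₛ tail g) (tail f *ₛ g) n) ⟩
    (f 0 * g 0 + 0#) * h (suc n) + (((f 0 ·ₛ tail g) *ₛ h) n + ((tail f *ₛ g) *ₛ h) n)
      ≈⟨ +-congˡ (+-cong (·ₛ-*ₛ (f 0) (tail g) h n) (*ₛ-assoc (tail f) g h n)) ⟩
    (f 0 * g 0 + 0#) * h (suc n) + (f 0 * (tail g *ₛ h) n + (tail f *ₛ (g *ₛ h)) n)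
      ≈⟨ solve 5 (λ x y z u v → (x :* y :+ con 0) :* z :+ (x :* u :+ v) := x :* (y :* z :+ u) :+ v) refl
           (f 0) (g 0) (h (suc n)) _ _ ⟩
    f 0 * (g 0 * h (suc n) + (tail g *ₛ h) n) + (tail f *ₛ (g *ₛ h)) n ∎

  -- The mirror image of the computational unfolding, with the second factor taken apart instead of
  -- the first; the two together give commutativity.
  *ₛ-suc : ∀ f g n → (f *ₛ g) (suc n) ≈ (f *ₛ tail g) n + f (suc n) * g 0
  *ₛ-suc f g zero    =
    solve 4 (λ x y z w → x :* y :+ (z :* w :+ con 0) := x :* y :+ con 0 :+ z :* w) refl
      (f 0) (g 1) (f 1) (g 0)
  *ₛ-suc f g (suc n) = trans (+-congˡ (*ₛ-suc (tail f) g n)) (sym (+-assoc _ _ _))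

  *ₛ-comm : ∀ f g n → (f *ₛ g) n ≈ (g *ₛ f) n
  *ₛ-comm f g zero    = +-congʳ (*-comm _ _)
  *ₛ-comm f g (suc n) = begin
    f 0 * g (suc n) + (tail f *ₛ g) n ≈⟨ +-cong (*-comm _ _) (*ₛ-comm (tail f) g n) ⟩
    g (suc n) * f 0 + (g *ₛ tail f) n ≈⟨ +-comm _ _ ⟩
    (g *ₛ tail f) n + g (suc n) * f 0 ≈⟨ *ₛ-suc g f n ⟨
    (g *ₛ f) (suc n)                  ∎

  zero-*ₛ : ∀ f g n → (∀ k → f k ≈ 0#) → (f *ₛ g) n ≈ 0#
  zero-*ₛ f g zero    f≈0 = trans (+-congʳ (trans (*-congʳ (f≈0 0)) (zeroˡ _))) (+-identityˡ _)
  zero-*ₛ f g (suc n) f≈0 =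
    trans (+-cong (trans (*-congʳ (f≈0 0)) (zeroˡ _)) (zero-*ₛ (tail f) g n (λ k → f≈0 (suc k))))
          (+-identityˡ _)

  const-*ₛ : ∀ a f → const a *ₛ f ≈ₛ a ·ₛ f
  const-*ₛ a f .coefficient zero    = +-identityʳ _
  const-*ₛ a f .coefficient (suc n) =
    trans (+-congˡ (zero-*ₛ (tail (const a)) f n (λ _ → refl))) (+-identityʳ _)

  const-cong : ∀ {a b} → a ≈ b → const a ≈ₛ const b
  const-cong a≈b .coefficient zero    = a≈b
  const-cong a≈b .coefficient (suc n) = refl

  const-+ : ∀ a b → const (a + b) ≈ₛ const a +ₛ const b
  const-+ a b .coefficient zero    = refl
  const-+ a b .coefficient (suc n) = sym (+-identityˡ 0#)

  *ₛ-identityˡ : ∀ f → const 1# *ₛ f ≈ₛ f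
  *ₛ-identityˡ f .coefficient n = trans (const-*ₛ 1# f .coefficient n) (*-identityˡ _)

  seriesRing : CommutativeRing c ℓ
  seriesRing = record
    { Carrier = Series
    ; _≈_ = _≈ₛ_
    ; _+_ = _+ₛ_
    ; _*_ = _*ₛ_
    ; -_ = -ₛ_
    ; 0# = λ _ → 0#
    ; 1# = const 1#
    ; isCommutativeRing = record
      { isRing = record
        { +-isAbelianGroup = record
          { isGroup = record
            { isMonoid = record
              { isSemigroup = record
                { isMagma = record
                  { isEquivalence = record
                    { refl = coefficients λ _ → refl
                    ; sym = λ p → coefficients λ n → sym (p .coefficient n)
                    ; trans = λ p r → coefficients λ n → trans (p .coefficient n) (r .coefficient n)
                    }
                  ; ∙-cong = +ₛ-cong
                  }
                ; assoc = λ f g h → coefficients λ n → +-assoc _ _ _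
                }
              ; identity = (λ f → coefficients λ n → +-identityˡ _)
                         , (λ f → coefficients λ n → +-identityʳ _)
              }
            ; inverse = (λ f → coefficients λ n → -‿inverseˡ _)
                      , (λ f → coefficients λ n → -‿inverseʳ _)
            ; ⁻¹-cong = λ p → coefficients λ n → -‿cong (p .coefficient n)
            }
          ; comm = λ f g → coefficients λ n → +-comm _ _
          }
        ; *-cong = *ₛ-cong
        ; *-assoc = λ f g h → coefficients (*ₛ-assoc f g h)
        ; *-identity = *ₛ-identityˡ
                     , (λ f → coefficients λ n →
                         trans (*ₛ-comm f (const 1#) n) (*ₛ-identityˡ f .coefficient n))
        ; distrib = (λ f g h → coefficients λ n → begin
                       (f *ₛ (g +ₛ h)) n         ≈⟨ *ₛ-comm f (g +ₛ h) n ⟩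
                       ((g +ₛ h) *ₛ f) n         ≈⟨ *ₛ-distribʳ f g h n ⟩
                       (g *ₛ f) n + (h *ₛ f) n   ≈⟨ +-cong (*ₛ-comm g f n) (*ₛ-comm h f n) ⟩
                       (f *ₛ g) n + (f *ₛ h) n   ∎)
                  , (λ f g h → coefficients (*ₛ-distribʳ f g h))
        }
      ; *-comm = λ f g → coefficients (*ₛ-comm f g)
      }
    }

  module Sₛ = CommutativeRing seriesRing

  module Solverₛ = SemiringSolver Sₛ.commutativeSemiring
  module ≈ₛ-Reasoning = SetoidReasoning Sₛ.setoid

  -- Substitution, rescaling and division of series

  *ₛ-shift : ∀ f g n → f 0 ≈ 0# → (f *ₛ g) (suc n) ≈ (tail f *ₛ g) n
  *ₛ-shift f g n f0≈0 = trans (+-congʳ (trans (*-congʳ f0≈0) (zeroˡ _))) (+-identityˡ _)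

  *ₛ-zero : ∀ f g → f 0 ≈ 0# → (f *ₛ g) 0 ≈ 0#
  *ₛ-zero f g f0≈0 = trans (+-identityʳ _) (trans (*-congʳ f0≈0) (zeroˡ _))

  tail-t : tail t ≈ₛ const 1#
  tail-t .coefficient zero    = refl
  tail-t .coefficient (suc n) = refl

  t-*ₛ : ∀ f n → (t *ₛ f) (suc n) ≈ f n
  t-*ₛ f n = begin
    (t *ₛ f) (suc n)   ≈⟨ *ₛ-shift t f n refl ⟩
    (tail t *ₛ f) n    ≈⟨ *ₛ-cong tail-t (Sₛ.refl {f}) .coefficient n ⟩
    (const 1# *ₛ f) n  ≈⟨ *ₛ-identityˡ f .coefficient n ⟩
    f n                ∎

  *ₛ-·ₛ : ∀ a f g n → (f *ₛ (a ·ₛ g)) n ≈ a * (f *ₛ g) n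
  *ₛ-·ₛ a f g n = begin
    (f *ₛ (a ·ₛ g)) n ≈⟨ *ₛ-comm f (a ·ₛ g) n ⟩
    ((a ·ₛ g) *ₛ f) n ≈⟨ ·ₛ-*ₛ a g f n ⟩
    a * (g *ₛ f) n    ≈⟨ *-congˡ (*ₛ-comm g f n) ⟩
    a * (f *ₛ g) n    ∎

  -- Substitution with the number N of terms decoupled from the coefficient n; `(a ⟨ u ⟩) n` is
  -- `partial a u (suc n) n`. For fixed N this is a finite sum of series and can be multiplied by u.
  partial : Series → Series → ℕ → Series
  partial a u N n = ∑< N (λ k → a k * (u ^ₛ k) n)

  *ₛ-∑< : ∀ f (b : ℕ → Carrier) (g : ℕ → Series) N n →
    (f *ₛ (λ m → ∑< N (λ k → b k * g k m))) n ≈ ∑< N (λ k → b k * (f *ₛ g k) n)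
  *ₛ-∑< f b g zero    n = Sₛ.zeroʳ f .coefficient n
  *ₛ-∑< f b g (suc N) n = trans
    (Sₛ.distribˡ f (b 0 ·ₛ g 0) (λ m → ∑< N (λ k → b (suc k) * g (suc k) m)) .coefficient n)
    (+-cong (*ₛ-·ₛ (b 0) f (g 0) n) (*ₛ-∑< f (tail b) (λ k → g (suc k)) N n))

  partial-suc : ∀ a u N n →
    partial a u (suc N) n ≈ const (a 0) n + (u *ₛ partial (tail a) u N) n
  partial-suc a u N n =
    +-cong (a0-const n) (sym (*ₛ-∑< u (tail a) (u ^ₛ_) N n))
    where
    a0-const : ∀ n → a 0 * const 1# n ≈ const (a 0) n
    a0-const zero    = *-identityʳ _
    a0-const (suc n) = zeroʳ _

  module _ {u : Series} (u0≈0 : u 0 ≈ 0#) where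

    -- Horner's rule takes one factor u out of both sums. As u has no constant term, coefficient
    -- `suc n` of the product sees only coefficients j ≤ n of the shorter sums, where the induction
    -- hypothesis applies.
    partial-stable : ∀ a M N n → n ℕ.< M → n ℕ.< N → partial a u M n ≈ partial a u N n
    partial-stable a (suc M) (suc N) n (ℕ.s≤s n≤M) (ℕ.s≤s n≤N) = begin
      partial a u (suc M) n                       ≈⟨ partial-suc a u M n ⟩
      const (a 0) n + (u *ₛ partial (tail a) u M) n ≈⟨ +-congˡ (step n n≤M n≤N) ⟩
      const (a 0) n + (u *ₛ partial (tail a) u N) n ≈⟨ partial-suc a u N n ⟨
      partial a u (suc N) n                       ∎
      where
      step : ∀ n → n ℕ.≤ M → n ℕ.≤ N →
        (u *ₛ partial (tail a) u M) n ≈ (u *ₛ partial (tail a) u N) n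
      step zero    _   _   = trans (*ₛ-zero u (partial (tail a) u M) u0≈0)
                                   (sym (*ₛ-zero u (partial (tail a) u N) u0≈0))
      step (suc n) n<M n<N = begin
        (u *ₛ partial (tail a) u M) (suc n) ≈⟨ *ₛ-shift u (partial (tail a) u M) n u0≈0 ⟩
        (tail u *ₛ partial (tail a) u M) n
          ≈⟨ *ₛ-congˡ-≤ (tail u) n (λ j j≤n →
               partial-stable (tail a) M N j (ℕ.≤-<-trans j≤n n<M) (ℕ.≤-<-trans j≤n n<N)) ⟩
        (tail u *ₛ partial (tail a) u N) n  ≈⟨ *ₛ-shift u (partial (tail a) u N) n u0≈0 ⟨
        (u *ₛ partial (tail a) u N) (suc n) ∎

    -- The Horner identity, and the only access to `_⟨_⟩` from here on.
    ⟨⟩-unfold : ∀ a → a ⟨ u ⟩ ≈ₛ const (a 0) +ₛ u *ₛ (tail a ⟨ u ⟩)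
    ⟨⟩-unfold a .coefficient n = trans (partial-suc a u n n) (+-congˡ (step n))
      where
      step : ∀ n → (u *ₛ partial (tail a) u n) n ≈ (u *ₛ (tail a ⟨ u ⟩)) n
      step zero    = trans (*ₛ-zero u (partial (tail a) u 0) u0≈0) (sym (*ₛ-zero u (tail a ⟨ u ⟩) u0≈0))
      step (suc n) = begin
        (u *ₛ partial (tail a) u (suc n)) (suc n) ≈⟨ *ₛ-shift u (partial (tail a) u (suc n)) n u0≈0 ⟩
        (tail u *ₛ partial (tail a) u (suc n)) n
          -- The left sum keeps `suc n` terms in every degree, while the substitution cuts its
          -- coefficient j after `suc j` terms; stability reconciles the two cuts.
          ≈⟨ *ₛ-congˡ-≤ (tail u) n (λ j j≤n →
               partial-stable (tail a) (suc n) (suc j) j (ℕ.s≤s j≤n) ℕ.≤-refl) ⟩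
        (tail u *ₛ (tail a ⟨ u ⟩)) n              ≈⟨ *ₛ-shift u (tail a ⟨ u ⟩) n u0≈0 ⟨
        (u *ₛ (tail a ⟨ u ⟩)) (suc n)             ∎

  -- The series f(a t).
  scale : Carrier → Series → Series
  scale a f n = a ^ n * f n

  -- The series u = a t is described by its head and tail so that both `-4t` and `t` itself, with a
  -- = 1, qualify. Each Horner step contributes one factor a.
  ⟨a·t⟩≈scale : ∀ {u a} → u 0 ≈ 0# → tail u ≈ₛ const a → ∀ f → f ⟨ u ⟩ ≈ₛ scale a f
  ⟨a·t⟩≈scale {u} {a} u0≈0 u′≈a f = coefficients (go f)
    where
    go : ∀ f n → (f ⟨ u ⟩) n ≈ scale a f n
    go f zero    = begin
      (f ⟨ u ⟩) 0                       ≈⟨ ⟨⟩-unfold {u} u0≈0 f .coefficient 0 ⟩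
      f 0 + (u *ₛ (tail f ⟨ u ⟩)) 0     ≈⟨ +-congˡ (*ₛ-zero u (tail f ⟨ u ⟩) u0≈0) ⟩
      f 0 + 0#                          ≈⟨ +-identityʳ _ ⟩
      f 0                               ≈⟨ *-identityˡ _ ⟨
      1# * f 0                          ∎
    go f (suc n) = begin
      (f ⟨ u ⟩) (suc n)                       ≈⟨ ⟨⟩-unfold {u} u0≈0 f .coefficient (suc n) ⟩
      0# + (u *ₛ (tail f ⟨ u ⟩)) (suc n)      ≈⟨ +-identityˡ _ ⟩
      (u *ₛ (tail f ⟨ u ⟩)) (suc n)           ≈⟨ *ₛ-shift u (tail f ⟨ u ⟩) n u0≈0 ⟩
      (tail u *ₛ (tail f ⟨ u ⟩)) n            ≈⟨ *ₛ-cong u′≈a (Sₛ.refl {tail f ⟨ u ⟩}) .coefficient n ⟩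
      (const a *ₛ (tail f ⟨ u ⟩)) n           ≈⟨ const-*ₛ a (tail f ⟨ u ⟩) .coefficient n ⟩
      a * (tail f ⟨ u ⟩) n                    ≈⟨ *-congˡ (go (tail f) n) ⟩
      a * (a ^ n * f (suc n))                 ≈⟨ *-assoc _ _ _ ⟨
      a * a ^ n * f (suc n)                   ∎

  scale-cong : ∀ a {f g} → f ≈ₛ g → scale a f ≈ₛ scale a g
  scale-cong a f≈g .coefficient n = *-congˡ (f≈g .coefficient n)

  -- The weight a^n splits as a^k a^(n-k). In the induction this appears as `tail (scale a f)` being
  -- a times `scale a (tail f)`.
  scale-*ₛ : ∀ a f g → scale a (f *ₛ g) ≈ₛ scale a f *ₛ scale a g
  scale-*ₛ a f g = coefficients (go f)
    where
    go : ∀ f n → scale a (f *ₛ g) n ≈ (scale a f *ₛ scale a g) n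
    go f zero    = begin
      1# * (f 0 * g 0 + 0#)          ≈⟨ *-identityˡ _ ⟩
      f 0 * g 0 + 0#                 ≈⟨ +-congʳ (*-cong (*-identityˡ _) (*-identityˡ _)) ⟨
      1# * f 0 * (1# * g 0) + 0#     ∎
    go f (suc n) = begin
      a * a ^ n * (f 0 * g (suc n) + (tail f *ₛ g) n)
        ≈⟨ solve 5 (λ a b x y z → a :* b :* (x :* y :+ z) := x :* (a :* b :* y) :+ a :* (b :* z)) refl
             a (a ^ n) (f 0) (g (suc n)) _ ⟩
      f 0 * (a * a ^ n * g (suc n)) + a * scale a (tail f *ₛ g) n
        ≈⟨ +-cong (*-congʳ (sym (*-identityˡ _))) (*-congˡ (go (tail f) n)) ⟩
      1# * f 0 * scale a g (suc n) + a * (scale a (tail f) *ₛ scale a g) n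
        ≈⟨ +-congˡ (·ₛ-*ₛ a (scale a (tail f)) (scale a g) n) ⟨
      1# * f 0 * scale a g (suc n) + ((a ·ₛ scale a (tail f)) *ₛ scale a g) n
        ≈⟨ +-congˡ (*ₛ-cong {a ·ₛ scale a (tail f)} {tail (scale a f)}
             (coefficients λ k → sym (*-assoc _ _ _)) (Sₛ.refl {scale a g}) .coefficient n) ⟩
      1# * f 0 * scale a g (suc n) + (tail (scale a f) *ₛ scale a g) n ∎

  -- With w = f / f 0 and u = 1 - w, the geometric series G in u satisfies G = 1 + u G, because
  -- `geometric` is its own tail. Also G = (u + w) G, and cancelling u G leaves w G = 1.
  ⁻¹ₛ-inverseʳ : ∀ f → ¬ (f 0 ≈ 0#) → f *ₛ f ⁻¹ₛ ≈ₛ const 1#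
  ⁻¹ₛ-inverseʳ f f0≉0 = Sₛ.trans f*f⁻¹≈w*G (+-cancelˡ (u *ₛ G) (w *ₛ G) (const 1#) uG+wG≈uG+1)
    where
    open RingProperties Sₛ.ring using (+-cancelˡ)
    w u G : Series
    w = f 0 ⁻¹ ·ₛ f
    u = const 1# -ₛ w
    G = geometric ⟨ u ⟩

    u0≈0 : u 0 ≈ 0#
    u0≈0 = trans (+-congˡ (-‿cong (trans (*-comm _ _) (inverseʳ f0≉0)))) (-‿inverseʳ 1#)

    f*f⁻¹≈w*G : f *ₛ f ⁻¹ₛ ≈ₛ w *ₛ G
    f*f⁻¹≈w*G .coefficient n = trans (*ₛ-·ₛ (f 0 ⁻¹) f G n) (sym (·ₛ-*ₛ (f 0 ⁻¹) f G n))

    u+w≈1 : u +ₛ w ≈ₛ const 1#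
    u+w≈1 = Sₛ.trans (Sₛ.+-assoc (const 1#) (-ₛ w) w)
      (Sₛ.trans (Sₛ.+-congˡ (Sₛ.-‿inverseˡ w)) (Sₛ.+-identityʳ (const 1#)))

    uG+wG≈uG+1 : u *ₛ G +ₛ w *ₛ G ≈ₛ u *ₛ G +ₛ const 1#
    uG+wG≈uG+1 = R.begin
      u *ₛ G +ₛ w *ₛ G    R.≈⟨ Sₛ.distribʳ G u w ⟨
      (u +ₛ w) *ₛ G       R.≈⟨ Sₛ.*-congʳ u+w≈1 ⟩
      const 1# *ₛ G       R.≈⟨ *ₛ-identityˡ G ⟩
      G                   R.≈⟨ ⟨⟩-unfold u0≈0 geometric ⟩
      const 1# +ₛ u *ₛ G  R.≈⟨ Sₛ.+-comm (const 1#) (u *ₛ G) ⟩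
      u *ₛ G +ₛ const 1#  R.∎
      where module R = ≈ₛ-Reasoning

  /ₛ-*ₛ : ∀ f g → ¬ (g 0 ≈ 0#) → f /ₛ g *ₛ g ≈ₛ f
  /ₛ-*ₛ f g g0≉0 = R.begin
    f *ₛ g ⁻¹ₛ *ₛ g    R.≈⟨ Sₛ.*-assoc f (g ⁻¹ₛ) g ⟩
    f *ₛ (g ⁻¹ₛ *ₛ g)  R.≈⟨ Sₛ.*-congˡ {f} (Sₛ.*-comm (g ⁻¹ₛ) g) ⟩
    f *ₛ (g *ₛ g ⁻¹ₛ)  R.≈⟨ Sₛ.*-congˡ {f} (⁻¹ₛ-inverseʳ g g0≉0) ⟩
    f *ₛ const 1#      R.≈⟨ Sₛ.*-identityʳ f ⟩
    f                  R.∎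
    where module R = ≈ₛ-Reasoning

  *ₛ-cancelʳ : ∀ {f g} h → ¬ (h 0 ≈ 0#) → f *ₛ h ≈ₛ g *ₛ h → f ≈ₛ g
  *ₛ-cancelʳ {f} {g} h h0≉0 fh≈gh = R.begin
    f                  R.≈⟨ fhh⁻¹≈f f ⟨
    f *ₛ h *ₛ h ⁻¹ₛ    R.≈⟨ Sₛ.*-congʳ fh≈gh ⟩
    g *ₛ h *ₛ h ⁻¹ₛ    R.≈⟨ fhh⁻¹≈f g ⟩
    g                  R.∎
    where
    module R = ≈ₛ-Reasoning
    fhh⁻¹≈f : ∀ f → f *ₛ h *ₛ h ⁻¹ₛ ≈ₛ f
    fhh⁻¹≈f f = Sₛ.trans (Sₛ.*-assoc f h (h ⁻¹ₛ))
      (Sₛ.trans (Sₛ.*-congˡ {f} (⁻¹ₛ-inverseʳ h h0≉0)) (Sₛ.*-identityʳ f))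

  -- t d/dt
  θ : Series → Series
  θ f n = fromℕ n * f n

  -- Leibniz rule, from n = k + (n - k). Using t d/dt rather than d/dt keeps coefficients in place,
  -- and `tail (θ f)` is `tail f +ₛ θ (tail f)`.
  θ-*ₛ : ∀ f g → θ (f *ₛ g) ≈ₛ θ f *ₛ g +ₛ f *ₛ θ g
  θ-*ₛ f g = coefficients (go f)
    where
    go : ∀ f n → θ (f *ₛ g) n ≈ (θ f *ₛ g) n + (f *ₛ θ g) n
    go f zero    =
      solve 2 (λ x y → con 0 :* (x :* y :+ con 0)
                    := con 0 :* x :* y :+ con 0 :+ (x :* (con 0 :* y) :+ con 0)) refl (f 0) (g 0)
    go f (suc n) = begin
      fromℕ (suc n) * (f 0 * g (suc n) + (tail f *ₛ g) n)
        ≈⟨ solve 4 (λ m x y z → (con 1 :+ m) :* (x :* y :+ z)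
                             := x :* ((con 1 :+ m) :* y) :+ (z :+ m :* z)) refl
             (fromℕ n) (f 0) (g (suc n)) _ ⟩
      f 0 * θ g (suc n) + ((tail f *ₛ g) n + θ (tail f *ₛ g) n)
        ≈⟨ +-congˡ (+-congˡ (go (tail f) n)) ⟩
      f 0 * θ g (suc n) + ((tail f *ₛ g) n + ((θ (tail f) *ₛ g) n + (tail f *ₛ θ g) n))
        ≈⟨ solve 6 (λ x y u v w z → x :* y :+ (u :+ (v :+ w))
                                 := con 0 :* x :* z :+ (u :+ v) :+ (x :* y :+ w)) refl
             (f 0) (θ g (suc n)) _ _ _ (g (suc n)) ⟩
      θ f 0 * g (suc n) + ((tail f *ₛ g) n + (θ (tail f) *ₛ g) n) + (f 0 * θ g (suc n) + (tail f *ₛ θ g) n)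
        ≈⟨ +-congʳ (+-congˡ (*ₛ-distribʳ g (tail f) (θ (tail f)) n)) ⟨
      θ f 0 * g (suc n) + ((tail f +ₛ θ (tail f)) *ₛ g) n + (f 0 * θ g (suc n) + (tail f *ₛ θ g) n)
        ≈⟨ +-congʳ (+-congˡ (*ₛ-cong {tail f +ₛ θ (tail f)} {tail (θ f)} (coefficients tail-θ)
             (Sₛ.refl {g}) .coefficient n)) ⟩
      θ f 0 * g (suc n) + (tail (θ f) *ₛ g) n + (f 0 * θ g (suc n) + (tail f *ₛ θ g) n) ∎
      where
      tail-θ : ∀ k → f (suc k) + fromℕ k * f (suc k) ≈ fromℕ (suc k) * f (suc k)
      tail-θ k = sym (trans (distribʳ _ _ _) (+-congʳ (*-identityˡ _)))

-- The ratio of consecutive central binomial coefficients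

centralBinomial-factorial : ∀ m → ((2 ℕ.* m) C m) ℕ.* (m ! ℕ.* m !) ≡ (2 ℕ.* m) !
centralBinomial-factorial m = begin
  ((2 ℕ.* m) C m) ℕ.* (m ! ℕ.* m !)
    ≡⟨ ≡.cong (λ k → ((2 ℕ.* m) C m) ℕ.* (m ! ℕ.* k !)) 2m∸m≡m ⟨
  ((2 ℕ.* m) C m) ℕ.* (m ! ℕ.* (2 ℕ.* m ∸ m) !)
    ≡⟨ ≡.cong (ℕ._* (m ! ℕ.* (2 ℕ.* m ∸ m) !)) (nCk≡n!/k![n-k]! m≤2m) ⟩
  ((2 ℕ.* m) ! ℕ./ (m ! ℕ.* (2 ℕ.* m ∸ m) !)) ℕ.* (m ! ℕ.* (2 ℕ.* m ∸ m) !)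
    ≡⟨ m/n*n≡m (k![n∸k]!∣n! m≤2m) ⟩
  (2 ℕ.* m) ! ∎
  where
  open ≡-Reasoning
  instance
    m!*[2m∸m]!≢0 : ℕ.NonZero (m ! ℕ.* (2 ℕ.* m ∸ m) !)
    m!*[2m∸m]!≢0 = m ℕ.!* (2 ℕ.* m ∸ m) !≢0
  m≤2m : m ℕ.≤ 2 ℕ.* m
  m≤2m = ℕ.m≤m+n m _
  2m∸m≡m : 2 ℕ.* m ∸ m ≡ m
  2m∸m≡m = ≡.trans (ℕ.m+n∸m≡n m (m ℕ.+ 0)) (ℕ.+-identityʳ m)

-- Multiplied by (m + 1) m!², both sides become (2m + 2)!.
centralBinomial-suc : ∀ m →
  suc m ℕ.* ((2 ℕ.* suc m) C suc m) ≡ (4 ℕ.* m ℕ.+ 2) ℕ.* ((2 ℕ.* m) C m)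
centralBinomial-suc m = ℕ.*-cancelʳ-≡ _ _ (suc m ℕ.* (f ℕ.* f)) (begin
  suc m ℕ.* Y ℕ.* (suc m ℕ.* (f ℕ.* f))
    ≡⟨ solve 3 (λ m f Y → (con 1 :+ m) :* Y :* ((con 1 :+ m) :* (f :* f))
                       := Y :* (((con 1 :+ m) :* f) :* ((con 1 :+ m) :* f))) ≡.refl m f Y ⟩
  Y ℕ.* (suc m ! ℕ.* suc m !)
    ≡⟨ centralBinomial-factorial (suc m) ⟩
  (2 ℕ.* suc m) !
    ≡⟨ ≡.cong _! (ℕ.*-suc 2 m) ⟩
  (2 ℕ.+ 2 ℕ.* m) ℕ.* ((1 ℕ.+ 2 ℕ.* m) ℕ.* (2 ℕ.* m) !)
    ≡⟨ ≡.cong (λ k → (2 ℕ.+ 2 ℕ.* m) ℕ.* ((1 ℕ.+ 2 ℕ.* m) ℕ.* k)) (centralBinomial-factorial m) ⟨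
  (2 ℕ.+ 2 ℕ.* m) ℕ.* ((1 ℕ.+ 2 ℕ.* m) ℕ.* (X ℕ.* (f ℕ.* f)))
    ≡⟨ solve 3 (λ m f X → (con 2 :+ con 2 :* m) :* ((con 1 :+ con 2 :* m) :* (X :* (f :* f)))
                       := (con 4 :* m :+ con 2) :* X :* ((con 1 :+ m) :* (f :* f))) ≡.refl m f X ⟩
  (4 ℕ.* m ℕ.+ 2) ℕ.* X ℕ.* (suc m ℕ.* (f ℕ.* f)) ∎)
  where
  open ≡-Reasoning
  open +-*-Solver
  f X Y : ℕ
  f = m !
  X = (2 ℕ.* m) C m
  Y = (2 ℕ.* suc m) C suc m
  instance
    [1+m]*m!*m!≢0 : ℕ.NonZero (suc m ℕ.* (f ℕ.* f))
    [1+m]*m!*m!≢0 = ℕ.m*n≢0 (suc m) (f ℕ.* f) {{_}} {{m ℕ.!* m !≢0}}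

-- Binomial series through their differential equation

module BinomialSeries {c ℓ} (K : Field c ℓ)
  (charZero : ∀ n → ¬ (Field._≈_ K (Field.fromℕ K (suc n)) (Field.0# K))) where
  open Field K
  open PowerSeries K
  open FieldProperties K
  open SeriesProperties K

  1/2 : Carrier
  1/2 = 1# / fromℕ 2

  1/2+1/2≈1 : 1/2 + 1/2 ≈ 1#
  1/2+1/2≈1 = trans
    (solve 1 (λ h → h :+ h := (con 1 :+ (con 1 :+ con 0)) :* h) refl 1/2)
    (x*[y/x]≈y (charZero 1))
    where open SemiringSolver commutativeSemiring

  -- (1 + t) f′ = a f, multiplied by t.  Such f are closed under products (adding
  -- the exponents) and determined by f 0, so binomial 1/2 squares to 1 + t.
  IsBinomial : Carrier → Series → Set ℓ
  IsBinomial a f = θ f +ₛ t *ₛ θ f ≈ₛ const a *ₛ (t *ₛ f)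

  module _ (a : Carrier) (f : Series) where
    private
      lhs≈ : ∀ n → (θ f +ₛ t *ₛ θ f) (suc n) ≈ fromℕ (suc n) * f (suc n) + fromℕ n * f n
      lhs≈ n = +-congˡ (t-*ₛ (θ f) n)

      rhs≈ : ∀ n → (const a *ₛ (t *ₛ f)) (suc n) ≈ a * f n
      rhs≈ n = trans (const-*ₛ a (t *ₛ f) .coefficient (suc n)) (*-congˡ (t-*ₛ f n))

    -- The equation between series suits products; the recurrence suits single coefficients, hence
    -- uniqueness and the check of concrete series.
    IsBinomial⇒recurrence : IsBinomial a f →
      ∀ n → fromℕ (suc n) * f (suc n) + fromℕ n * f n ≈ a * f n
    IsBinomial⇒recurrence ode n =
      trans (sym (lhs≈ n)) (trans (ode .coefficient (suc n)) (rhs≈ n))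

    recurrence⇒IsBinomial :
      (∀ n → fromℕ (suc n) * f (suc n) + fromℕ n * f n ≈ a * f n) → IsBinomial a f
    recurrence⇒IsBinomial rec .coefficient zero    = trans
      (+-cong (zeroˡ _) (*ₛ-zero t (θ f) refl))
      (trans (+-identityʳ _) (sym (trans (const-*ₛ a (t *ₛ f) .coefficient 0)
        (trans (*-congˡ (*ₛ-zero t f refl)) (zeroʳ _)))))
    recurrence⇒IsBinomial rec .coefficient (suc n) =
      trans (lhs≈ n) (trans (rec n) (sym (rhs≈ n)))

  binomial-IsBinomial : ∀ a → IsBinomial a (binomial a)
  binomial-IsBinomial a = recurrence⇒IsBinomial a (binomial a) λ n →
    let b = binomial a n in begin
    fromℕ (suc n) * binomial a (suc n) + fromℕ n * b
      ≈⟨ +-congʳ (x*[y/x]≈y (charZero n)) ⟩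
    b * (a - fromℕ n) + fromℕ n * b
      ≈⟨ solve 4 (λ a b m m⁻ → b :* (a :+ m⁻) :+ m :* b := a :* b :+ (m :+ m⁻) :* b) refl
           a b (fromℕ n) (- fromℕ n) ⟩
    a * b + (fromℕ n - fromℕ n) * b
      ≈⟨ +-congˡ (trans (*-congʳ (-‿inverseʳ (fromℕ n))) (zeroˡ b)) ⟩
    a * b + 0#
      ≈⟨ +-identityʳ _ ⟩
    a * b ∎
    where
    open SetoidReasoning setoid
    open SemiringSolver commutativeSemiring

  -- By Leibniz, (1 + t)(f g)′ = ((1 + t) f′) g + f ((1 + t) g′).
  IsBinomial-* : ∀ {a b f g} → IsBinomial a f → IsBinomial b g → IsBinomial (a + b) (f *ₛ g)
  IsBinomial-* {a} {b} {f} {g} ode-f ode-g = begin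
    θ (f *ₛ g) +ₛ t *ₛ θ (f *ₛ g)
      ≈⟨ +ₛ-cong (θ-*ₛ f g) (*ₛ-cong (Sₛ.refl {t}) (θ-*ₛ f g)) ⟩
    (θ f *ₛ g +ₛ f *ₛ θ g) +ₛ t *ₛ (θ f *ₛ g +ₛ f *ₛ θ g)
      ≈⟨ solve 5 (λ t f g f′ g′ → (f′ :* g :+ f :* g′) :+ t :* (f′ :* g :+ f :* g′)
                               := (f′ :+ t :* f′) :* g :+ f :* (g′ :+ t :* g′)) Sₛ.refl
           t f g (θ f) (θ g) ⟩
    (θ f +ₛ t *ₛ θ f) *ₛ g +ₛ f *ₛ (θ g +ₛ t *ₛ θ g)
      ≈⟨ +ₛ-cong (*ₛ-cong ode-f (Sₛ.refl {g})) (*ₛ-cong (Sₛ.refl {f}) ode-g) ⟩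
    const a *ₛ (t *ₛ f) *ₛ g +ₛ f *ₛ (const b *ₛ (t *ₛ g))
      ≈⟨ solve 5 (λ t f g a b → a :* (t :* f) :* g :+ f :* (b :* (t :* g))
                             := (a :+ b) :* (t :* (f :* g))) Sₛ.refl
           t f g (const a) (const b) ⟩
    (const a +ₛ const b) *ₛ (t *ₛ (f *ₛ g))
      ≈⟨ *ₛ-cong (const-+ a b) (Sₛ.refl {t *ₛ (f *ₛ g)}) ⟨
    const (a + b) *ₛ (t *ₛ (f *ₛ g)) ∎
    where
    open ≈ₛ-Reasoning
    open Solverₛ

  IsBinomial-cong : ∀ {a b} f → a ≈ b → IsBinomial a f → IsBinomial b f
  IsBinomial-cong f a≈b ode =
    Sₛ.trans ode (*ₛ-cong (const-cong a≈b) (Sₛ.refl {t *ₛ f}))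

  IsBinomial-unique : ∀ {a f g} → IsBinomial a f → IsBinomial a g → f 0 ≈ g 0 → f ≈ₛ g
  IsBinomial-unique {a} {f} {g} ode-f ode-g f0≈g0 = coefficients go
    where
    open SetoidReasoning setoid
    open RingProperties ring using (+-cancelʳ)
    go : ∀ n → f n ≈ g n
    go zero    = f0≈g0
    go (suc n) = *-cancelˡ (charZero n) (+-cancelʳ (fromℕ n * f n) _ _ (begin
      fromℕ (suc n) * f (suc n) + fromℕ n * f n ≈⟨ IsBinomial⇒recurrence a f ode-f n ⟩
      a * f n                                   ≈⟨ *-congˡ (go n) ⟩
      a * g n                                   ≈⟨ IsBinomial⇒recurrence a g ode-g n ⟨
      fromℕ (suc n) * g (suc n) + fromℕ n * g n ≈⟨ +-congˡ (*-congˡ (go n)) ⟨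
      fromℕ (suc n) * g (suc n) + fromℕ n * f n ∎))

  1+t-IsBinomial : IsBinomial 1# (const 1# +ₛ t)
  1+t-IsBinomial = recurrence⇒IsBinomial 1# (const 1# +ₛ t) λ where
      zero          → solve 0 ((con 1 :+ con 0) :* (con 0 :+ con 1) :+ con 0 :* (con 1 :+ con 0)
                        := con 1 :* (con 1 :+ con 0)) refl
      (suc zero)    → solve 0 ((con 1 :+ (con 1 :+ con 0)) :* (con 0 :+ con 0)
                        :+ (con 1 :+ con 0) :* (con 0 :+ con 1)
                        := con 1 :* (con 0 :+ con 1)) refl
      (suc (suc n)) → solve 2 (λ x y → x :* (con 0 :+ con 0) :+ y :* (con 0 :+ con 0)
                        := con 1 :* (con 0 :+ con 0)) refl (fromℕ (3 ℕ.+ n)) (fromℕ (2 ℕ.+ n))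
    where open SemiringSolver commutativeSemiring

  binomial-½-square : binomial 1/2 *ₛ binomial 1/2 ≈ₛ const 1# +ₛ t
  binomial-½-square = IsBinomial-unique
    (IsBinomial-cong (binomial 1/2 *ₛ binomial 1/2) 1/2+1/2≈1
      (IsBinomial-* (binomial-IsBinomial 1/2) (binomial-IsBinomial 1/2)))
    1+t-IsBinomial
    (+-congʳ (*-identityʳ 1#))

-- Valuations, and why q differs from -1

odd⇒1+k*2 : ∀ n → ¬ (2 ∣ n) → ∃ λ k → n ≡ 1 ℕ.+ k ℕ.* 2
odd⇒1+k*2 n 2∤n with n ℕ.% 2 in n%2≡r | m%n<n n 2 | m≡m%n+[m/n]*n n 2
... | 0 | _ | _  = contradiction (m%n≡0⇒n∣m n 2 n%2≡r) 2∤n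
... | 1 | _ | eq = n ℕ./ 2 , eq
... | suc (suc _) | ℕ.s≤s (ℕ.s≤s ()) | _

0<1/[p-1] : ∀ {p} (pp : Prime p) → 0ℚ ℚ.< 1/[ pp -1]
0<1/[p-1] {p} pp = ℚ.positive⁻¹ 1/[ pp -1] {{ℚ.normalize-pos 1 (p ∸ 1) {{p-1≢0}}}}
  where
  p-1≢0 : ℕ.NonZero (p ∸ 1)
  p-1≢0 = ℕ.≢-nonZero (ℕ.m>n⇒m∸n≢0 (ℕ.nonTrivial⇒n>1 p {{prime⇒nonTrivial pp}}))

≤⁺-+⁺ : ∀ {r} a b → [ 0ℚ ] ≤⁺ a → [ r ] ≤⁺ b → [ r ] ≤⁺ a +⁺ b
≤⁺-+⁺ {r} [ a ] [ b ] [ 0≤a ] [ r≤b ] =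
  [ ≡.subst (ℚ._≤ a ℚ.+ b) (ℚ.+-identityˡ r) (ℚ.+-mono-≤ 0≤a r≤b) ]
≤⁺-+⁺ [ a ] ⊤⁺ _ _ = _ ≤⊤⁺
≤⁺-+⁺ ⊤⁺ _ _ _ = _ ≤⊤⁺

0≤a+⁺a⇒0≤a : ∀ a → [ 0ℚ ] ≤⁺ a +⁺ a → [ 0ℚ ] ≤⁺ a
0≤a+⁺a⇒0≤a [ a ] [ 0≤a+a ] =
  [ ℚ.≮⇒≥ (λ a<0 → ℚ.<-irrefl ≡.refl (ℚ.<-≤-trans (ℚ.+-mono-< a<0 a<0) 0≤a+a)) ]
0≤a+⁺a⇒0≤a ⊤⁺ _ = _ ≤⊤⁺

-- Meant for a = v(1), where 1 = 1 * 1; the other solution ⊤⁺ is the valuation of zero.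
a≡a+⁺a⇒a≡0 : ∀ a → ¬ (a ≡ ⊤⁺) → a ≡ a +⁺ a → a ≡ [ 0ℚ ]
a≡a+⁺a⇒a≡0 [ a ] _ eq = ≡.cong [_] (identityʳ-unique a a (≡.sym ([]-injective eq)))
  where open GroupProperties ℚ.+-0-group using (identityʳ-unique)
a≡a+⁺a⇒a≡0 ⊤⁺ a≢⊤ _ = contradiction ≡.refl a≢⊤

<⁺⇒≤⁺ : ∀ {r} a → [ r ] <⁺ a → [ r ] ≤⁺ a
<⁺⇒≤⁺ [ a ] [ r<a ] = [ ℚ.<⇒≤ r<a ]
<⁺⇒≤⁺ ⊤⁺ _ = _ ≤⊤⁺

module Valuation {c ℓ} {p : ℕ} (ℂₚ : ComplexPadic p c ℓ) where
  open ComplexPadic ℂₚ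
  open FieldProperties fld
  open RingProperties ring

  v-1 : v 1# ≡ [ 0ℚ ]
  v-1 = a≡a+⁺a⇒a≡0 (v 1#) (λ v1≡⊤ → 1≉0 (v-⊤ v1≡⊤))
    (≡.trans (v-cong (sym (*-identityˡ 1#))) (v-* 1# 1#))

  -- The square of -1 is 1, so twice the valuation is 0.
  0≤v[-1] : [ 0ℚ ] ≤⁺ v (- 1#)
  0≤v[-1] = 0≤a+⁺a⇒0≤a (v (- 1#)) (≡.subst ([ 0ℚ ] ≤⁺_) 0≡v+v [ ℚ.≤-refl ])
    where
    0≡v+v : [ 0ℚ ] ≡ v (- 1#) +⁺ v (- 1#)
    0≡v+v = ≡.trans (≡.sym v-1)
      (≡.trans (v-cong (sym (trans (-1*x≈-x (- 1#)) (-‿involutive 1#)))) (v-* (- 1#) (- 1#)))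

  0≤v[fromℕ] : ∀ n → [ 0ℚ ] ≤⁺ v (fromℕ n)
  0≤v[fromℕ] zero    = ≡.subst ([ 0ℚ ] ≤⁺_) (≡.sym v-0) (_ ≤⊤⁺)
  0≤v[fromℕ] (suc n) =
    v-ultrametric 1# (fromℕ n) (≡.subst ([ 0ℚ ] ≤⁺_) (≡.sym v-1) [ ℚ.≤-refl ]) (0≤v[fromℕ] n)

  v-*-≥ : ∀ {r} x y → [ 0ℚ ] ≤⁺ v x → [ r ] ≤⁺ v y → [ r ] ≤⁺ v (x * y)
  v-*-≥ x y 0≤vx r≤vy =
    ≡.subst ([ _ ] ≤⁺_) (≡.sym (v-* x y)) (≤⁺-+⁺ (v x) (v y) 0≤vx r≤vy)

  -- Otherwise p and 2 would both have positive valuation, and with them 1 = p - k * 2.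
  v[2]≯0 : ¬ (2 ∣ p) → ∀ {r} → 0ℚ ℚ.< r → ¬ ([ r ] ≤⁺ v (fromℕ 2))
  v[2]≯0 2∤p {r} 0<r r≤v2 with odd⇒1+k*2 p 2∤p
  ... | k , p≡1+k*2 = ℚ.<-irrefl ≡.refl (ℚ.<-≤-trans 0<s (case-v1 s≤v1))
    where
    -- A common positive lower bound: r bounds the valuation of 2, and 1 is the valuation of p.
    s : ℚ
    s = r ℚ.⊓ 1ℚ

    0<s : 0ℚ ℚ.< s
    0<s with ℚ.⊓-sel r 1ℚ
    ... | inj₁ s≡r = ≡.subst (0ℚ ℚ.<_) (≡.sym s≡r) 0<r
    ... | inj₂ s≡1 = ≡.subst (0ℚ ℚ.<_) (≡.sym s≡1) (ℚ.positive⁻¹ 1ℚ)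

    case-v1 : [ s ] ≤⁺ v 1# → s ℚ.≤ 0ℚ
    case-v1 s≤v1 with ≡.subst ([ s ] ≤⁺_) v-1 s≤v1
    ... | [ s≤0 ] = s≤0

    s≤v2 : [ s ] ≤⁺ v (fromℕ 2)
    s≤v2 = ≤⁺-trans ℚ.≤-trans [ ℚ.p⊓q≤p r 1ℚ ] r≤v2

    s≤vp : [ s ] ≤⁺ v (fromℕ p)
    s≤vp = ≡.subst ([ s ] ≤⁺_) (≡.sym v-p) [ ℚ.p⊓q≤q r 1ℚ ]

    -- The difference is written as a sum with a factor -1, the form to which the ultrametric
    -- inequality and `0≤v[-1]` apply.
    p-k*2≈1 : fromℕ p + - 1# * (fromℕ k * fromℕ 2) ≈ 1#
    p-k*2≈1 = begin
      fromℕ p + - 1# * (fromℕ k * fromℕ 2)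
        ≈⟨ +-cong (reflexive (≡.cong fromℕ p≡1+k*2)) (*-congˡ (sym (fromℕ-* k 2))) ⟩
      1# + fromℕ (k ℕ.* 2) + - 1# * fromℕ (k ℕ.* 2)
        ≈⟨ +-congˡ (-1*x≈-x _) ⟩
      1# + fromℕ (k ℕ.* 2) - fromℕ (k ℕ.* 2)
        ≈⟨ +-assoc _ _ _ ⟩
      1# + (fromℕ (k ℕ.* 2) - fromℕ (k ℕ.* 2))
        ≈⟨ +-congˡ (-‿inverseʳ _) ⟩
      1# + 0#
        ≈⟨ +-identityʳ 1# ⟩
      1# ∎
      where open SetoidReasoning setoid

    s≤v1 : [ s ] ≤⁺ v 1#
    s≤v1 = ≡.subst ([ s ] ≤⁺_) (v-cong p-k*2≈1)
      (v-ultrametric _ _ s≤vp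
        (v-*-≥ _ _ 0≤v[-1] (v-*-≥ _ _ (0≤v[fromℕ] k) s≤v2)))

  1+q≉0 : ¬ (2 ∣ p) → ∀ {q r} → 0ℚ ℚ.< r → ∣ 1# - q ∣<p^- r → ¬ (q + 1# ≈ 0#)
  1+q≉0 2∤p {q} 0<r r<v[1-q] q+1≈0 =
    v[2]≯0 2∤p 0<r (≡.subst ([ _ ] ≤⁺_) (v-cong 1-q≈2) (<⁺⇒≤⁺ _ r<v[1-q]))
    where
    1-q≈2 : 1# - q ≈ fromℕ 2
    1-q≈2 = +-congˡ (trans (sym (+-inverseʳ-unique q 1# q+1≈0)) (sym (+-identityʳ 1#)))

-- Catalan numbers as coefficients of √(1 - 4t)

module CatalanDaeheeProperties {c ℓ} {p : ℕ} (ℂₚ : ComplexPadic p c ℓ) where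
  open ComplexPadic ℂₚ
  open PowerSeries fld
  open CatalanDaehee ℂₚ
  open FieldProperties fld
  open SeriesProperties fld
  open BinomialSeries fld charZero
  open RingProperties ring
  open SemiringSolver commutativeSemiring
  open SetoidReasoning setoid
  open Sum +-commutativeMonoid using (sum-cong-≋)

  private
    -- Spelled as 1 + (1 + ... + 0), the shape to which `fromℕ` unfolds, so that solved equations
    -- match the numerals of the field by computation.
    lit : ∀ {k} → ℕ → Polynomial k
    lit zero    = con 0
    lit (suc n) = con 1 :+ lit n

    -4# -2# : Carrier
    -4# = - fromℕ 4
    -2# = - fromℕ 2

  fromℕ≉0 : ∀ n .{{_ : ℕ.NonZero n}} → ¬ (fromℕ n ≈ 0#)
  fromℕ≉0 (suc n) = charZero n

  catalan-binomial : ∀ m → fromℕ (suc m) * catalan m ≈ fromℕ ((2 ℕ.* m) C m)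
  catalan-binomial m = begin
    fromℕ (suc m) * (1# / fromℕ (suc m) * fromℕ ((2 ℕ.* m) C m)) ≈⟨ *-assoc _ _ _ ⟨
    fromℕ (suc m) * (1# / fromℕ (suc m)) * fromℕ ((2 ℕ.* m) C m) ≈⟨ *-congʳ (x*[y/x]≈y (charZero m)) ⟩
    1# * fromℕ ((2 ℕ.* m) C m)                                   ≈⟨ *-identityˡ _ ⟩
    fromℕ ((2 ℕ.* m) C m)                                        ∎

  -- Multiplied by m + 1, this is the recurrence of the central binomial coefficients, as (m + 1)
  -- C_m is one of them.
  catalan-suc : ∀ m → fromℕ (2 ℕ.+ m) * catalan (suc m) ≈ (fromℕ 4 * fromℕ m + fromℕ 2) * catalan m
  catalan-suc m = *-cancelˡ (charZero m) (begin
    fromℕ (suc m) * (fromℕ (2 ℕ.+ m) * catalan (suc m))   ≈⟨ *-congˡ (catalan-binomial (suc m)) ⟩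
    fromℕ (suc m) * fromℕ ((2 ℕ.* suc m) C suc m)         ≈⟨ fromℕ-* (suc m) ((2 ℕ.* suc m) C suc m) ⟨
    fromℕ (suc m ℕ.* ((2 ℕ.* suc m) C suc m))             ≈⟨ reflexive (≡.cong fromℕ (centralBinomial-suc m)) ⟩
    fromℕ ((4 ℕ.* m ℕ.+ 2) ℕ.* ((2 ℕ.* m) C m))           ≈⟨ fromℕ-* (4 ℕ.* m ℕ.+ 2) ((2 ℕ.* m) C m) ⟩
    fromℕ (4 ℕ.* m ℕ.+ 2) * fromℕ ((2 ℕ.* m) C m)
      ≈⟨ *-cong (trans (fromℕ-+ (4 ℕ.* m) 2) (+-congʳ (fromℕ-* 4 m))) (sym (catalan-binomial m)) ⟩
    (fromℕ 4 * fromℕ m + fromℕ 2) * (fromℕ (suc m) * catalan m)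
      ≈⟨ solve 3 (λ x y z → x :* (y :* z) := y :* (x :* z)) refl _ _ _ ⟩
    fromℕ (suc m) * ((fromℕ 4 * fromℕ m + fromℕ 2) * catalan m) ∎)

  -4t₀≈0 : -4t 0 ≈ 0#
  -4t₀≈0 = zeroʳ _

  tail[-4t]≈-4 : tail -4t ≈ₛ const -4#
  tail[-4t]≈-4 .coefficient zero    = *-identityʳ _
  tail[-4t]≈-4 .coefficient (suc n) = zeroʳ _

  √≈scale : √1+ -4t ≈ₛ scale -4# (binomial 1/2)
  √≈scale = ⟨a·t⟩≈scale -4t₀≈0 tail[-4t]≈-4 (binomial 1/2)

  √-square : √1+ -4t *ₛ √1+ -4t ≈ₛ scale -4# (const 1# +ₛ t)
  √-square = Sₛ.trans (*ₛ-cong √≈scale √≈scale)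
    (Sₛ.trans (Sₛ.sym (scale-*ₛ -4# (binomial 1/2) (binomial 1/2)))
      (scale-cong -4# binomial-½-square))

  -- Coefficient form of (1 - 4t) s′ = -2 s: the recurrence of `binomial 1/2` multiplied by
  -- (-4)^(m+1), with -2 = -4 · 1/2.
  √-recurrence : ∀ m → let s = scale -4# (binomial 1/2) in
    fromℕ (suc m) * s (suc m) + -4# * (fromℕ m * s m) ≈ -2# * s m
  √-recurrence m = begin
    fromℕ (suc m) * (-4# * x * b (suc m)) + -4# * (fromℕ m * (x * b m))
      ≈⟨ solve 6 (λ n m y x b b′ → n :* (y :* x :* b′) :+ y :* (m :* (x :* b))
                              := y :* x :* (n :* b′ :+ m :* b)) refl
           (fromℕ (suc m)) (fromℕ m) -4# x (b m) (b (suc m)) ⟩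
    -4# * x * (fromℕ (suc m) * b (suc m) + fromℕ m * b m)
      ≈⟨ *-congˡ (IsBinomial⇒recurrence 1/2 b (binomial-IsBinomial 1/2) m) ⟩
    -4# * x * (1/2 * b m)
      ≈⟨ solve 4 (λ y x h b → y :* x :* (h :* b) := y :* h :* (x :* b)) refl -4# x 1/2 (b m) ⟩
    -4# * 1/2 * (x * b m)
      ≈⟨ *-congʳ -4/2≈-2 ⟩
    -2# * (x * b m) ∎
    where
    b : Series
    b = binomial 1/2
    x : Carrier
    x = -4# ^ m
    -4/2≈-2 : -4# * 1/2 ≈ -2#
    -4/2≈-2 = begin
      - fromℕ 4 * 1/2     ≈⟨ -‿distribˡ-* (fromℕ 4) 1/2 ⟨
      - (fromℕ 4 * 1/2)
        ≈⟨ -‿cong (solve 1 (λ h → lit 4 :* h := lit 2 :* (h :+ h)) refl 1/2) ⟩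
      - (fromℕ 2 * (1/2 + 1/2)) ≈⟨ -‿cong (trans (*-congˡ 1/2+1/2≈1) (*-identityʳ _)) ⟩
      - fromℕ 2 ∎

  -- The recurrence for s gives (m + 2) s_(m+2) = (4 (m + 1) - 2) s_(m+1) = (4m + 2) s_(m+1), which
  -- is `catalan-suc` with C_m in place of s_(m+1). The factor -2 is fixed by s_1 = -2 and C_0 = 1.
  √-catalan : ∀ m → √1+ -4t (suc m) ≈ -2# * catalan m
  √-catalan m = trans (√≈scale .coefficient (suc m)) (go m)
    where
    s : Series
    s = scale -4# (binomial 1/2)
    go : ∀ m → s (suc m) ≈ -2# * catalan m
    go zero    = begin
      s 1
        ≈⟨ solve 2 (λ s y → s := lit 1 :* s :+ y :* (con 0 :* (con 1 :* con 1))) refl (s 1) -4# ⟩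
      fromℕ 1 * s 1 + -4# * (fromℕ 0 * s 0)     ≈⟨ √-recurrence 0 ⟩
      -2# * (1# * 1#)                           ≈⟨ *-congˡ (*-congʳ (x*[y/x]≈y (charZero 0))) ⟨
      -2# * (fromℕ 1 * (1# / fromℕ 1) * 1#)
        ≈⟨ *-congˡ (solve 1 (λ z → lit 1 :* z :* con 1 := z :* lit 1) refl (1# / fromℕ 1)) ⟩
      -2# * (1# / fromℕ 1 * fromℕ 1) ∎
    go (suc m) = *-cancelˡ (charZero (suc m)) (begin
      A
        ≈⟨ +-identityʳ A ⟨
      A + 0#
        -- A zero, written as (-4 + 4) times a term, supplies the summand that `√-recurrence`
        -- expects and leaves its opposite behind.
        ≈⟨ +-congˡ (trans (*-congʳ (-‿inverseˡ (fromℕ 4))) (zeroˡ _)) ⟨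
      A + (-4# + fromℕ 4) * (fromℕ (suc m) * s₁)
        ≈⟨ solve 4 (λ a y m s → a :+ (y :+ lit 4) :* ((con 1 :+ m) :* s)
                             := (a :+ y :* ((con 1 :+ m) :* s)) :+ lit 4 :* ((con 1 :+ m) :* s)) refl
             A -4# (fromℕ m) s₁ ⟩
      A + -4# * (fromℕ (suc m) * s₁) + fromℕ 4 * (fromℕ (suc m) * s₁)
        ≈⟨ +-congʳ (√-recurrence (suc m)) ⟩
      -2# * s₁ + fromℕ 4 * (fromℕ (suc m) * s₁)
        ≈⟨ solve 3 (λ y m s → y :* s :+ lit 4 :* ((con 1 :+ m) :* s)
                           := (lit 4 :* m :+ lit 2) :* s :+ (y :+ lit 2) :* s) refl
             -2# (fromℕ m) s₁ ⟩
      (fromℕ 4 * fromℕ m + fromℕ 2) * s₁ + (-2# + fromℕ 2) * s₁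
        ≈⟨ +-congˡ (trans (*-congʳ (-‿inverseˡ (fromℕ 2))) (zeroˡ _)) ⟩
      (fromℕ 4 * fromℕ m + fromℕ 2) * s₁ + 0#
        ≈⟨ +-identityʳ _ ⟩
      (fromℕ 4 * fromℕ m + fromℕ 2) * s₁
        ≈⟨ *-congˡ (go m) ⟩
      (fromℕ 4 * fromℕ m + fromℕ 2) * (-2# * catalan m)
        ≈⟨ solve 3 (λ x y z → x :* (y :* z) := y :* (x :* z)) refl _ -2# (catalan m) ⟩
      -2# * ((fromℕ 4 * fromℕ m + fromℕ 2) * catalan m)
        ≈⟨ *-congˡ (catalan-suc m) ⟨
      -2# * (fromℕ (2 ℕ.+ m) * catalan (suc m))
        ≈⟨ solve 3 (λ x y z → y :* (x :* z) := x :* (y :* z)) refl _ -2# (catalan (suc m)) ⟩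
      fromℕ (2 ℕ.+ m) * (-2# * catalan (suc m)) ∎)
      where
      s₁ A : Carrier
      s₁ = s (suc m)
      A = fromℕ (2 ℕ.+ m) * s (2 ℕ.+ m)

  log1+-4t≈scale : log1+ -4t ≈ₛ scale -4# logarithmic
  log1+-4t≈scale = ⟨a·t⟩≈scale -4t₀≈0 tail[-4t]≈-4 logarithmic

  log1+t≈logarithmic : log1+ t ≈ₛ logarithmic
  log1+t≈logarithmic .coefficient n = begin
    log1+ t n              ≈⟨ ⟨a·t⟩≈scale {t} {1#} refl tail-t logarithmic .coefficient n ⟩
    1# ^ n * logarithmic n ≈⟨ *-congʳ (1^n≈1 n) ⟩
    1# * logarithmic n     ≈⟨ *-identityˡ _ ⟩
    logarithmic n          ∎

  -- The generating functions of D and d compared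

  module _ (q logq : Carrier) (q-1≉0 : ¬ (q - 1# ≈ 0#)) (q+1≉0 : ¬ (q + 1# ≈ 0#)) where

    private
      k : Carrier
      k = (q - 1#) / logq

      -- The numerators and denominators repeat those local to `D` and `d`, with which they agree by
      -- computation. `F` is the exponential generating function of `D`, and `M-d` is `Q` minus 1.
      N-D M-D N-d M-d F Q : Series
      N-D = const (fromℕ 2 * (q - 1#)) +ₛ k ·ₛ log1+ t
      M-D = q ^ 2 ·ₛ (const 1# +ₛ t) -ₛ const 1#
      N-d = const (q - 1#) +ₛ (k * 1/2) ·ₛ log1+ -4t
      M-d = q ·ₛ √1+ -4t -ₛ const 1#
      F   = N-D /ₛ M-D
      Q   = q ·ₛ √1+ -4t

      √₀≈1 : √1+ -4t 0 ≈ 1#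
      √₀≈1 = trans (√≈scale .coefficient 0) (*-identityˡ 1#)

      M-d₀≈q-1 : M-d 0 ≈ q - 1#
      M-d₀≈q-1 = +-congʳ (trans (*-congˡ √₀≈1) (*-identityʳ q))

      M-d₀≉0 : ¬ (M-d 0 ≈ 0#)
      M-d₀≉0 M-d₀≈0 = q-1≉0 (trans (sym M-d₀≈q-1) M-d₀≈0)

      [q-1][q+1]≈q²-1 : (q - 1#) * (q + 1#) ≈ q ^ 2 - 1#
      [q-1][q+1]≈q²-1 = trans ([x-1][x+1]≈x²-1 commutativeRing q)
        (+-congʳ (*-congˡ (sym (*-identityʳ q))))

      M-D₀≉0 : ¬ (M-D 0 ≈ 0#)
      M-D₀≉0 M-D₀≈0 = *-nonZero q-1≉0 q+1≉0 (begin
        (q - 1#) * (q + 1#)      ≈⟨ [q-1][q+1]≈q²-1 ⟩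
        q ^ 2 - 1#               ≈⟨ +-congʳ (trans (*-congˡ (+-identityʳ 1#)) (*-identityʳ _)) ⟨
        q ^ 2 * (1# + 0#) - 1#   ≈⟨ M-D₀≈0 ⟩
        0#                       ∎)

      scale-const : ∀ a b n → a ^ n * const b n ≈ const b n
      scale-const a b zero    = *-identityˡ b
      scale-const a b (suc n) = zeroʳ _

      scale-M-D : scale -4# M-D ≈ₛ M-d *ₛ (Q +ₛ const 1#)
      scale-M-D .coefficient n = begin
        x * (q ^ 2 * (const 1# +ₛ t) n - const 1# n)
          ≈⟨ solve 4 (λ x q y o → x :* (q :* y :+ o) := q :* (x :* y) :+ x :* o) refl
               x (q ^ 2) ((const 1# +ₛ t) n) (- const 1# n) ⟩
        q ^ 2 * (x * (const 1# +ₛ t) n) + x * - const 1# n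
          ≈⟨ +-cong (*-congˡ (sym (√-square .coefficient n)))
               (trans (sym (-‿distribʳ-* x (const 1# n))) (-‿cong (scale-const -4# 1# n))) ⟩
        q ^ 2 * (√1+ -4t *ₛ √1+ -4t) n - const 1# n
          ≈⟨ +-congʳ (solve 2 (λ q y → q :* (q :* con 1) :* y := q :* (q :* y)) refl q _) ⟩
        q * (q * (√1+ -4t *ₛ √1+ -4t) n) - const 1# n
          ≈⟨ +-congʳ (trans (·ₛ-*ₛ q (√1+ -4t) Q n) (*-congˡ (*ₛ-·ₛ q (√1+ -4t) (√1+ -4t) n))) ⟨
        (Q *ₛ Q) n - const 1# n
          ≈⟨ [x-1][x+1]≈x²-1 seriesRing Q .coefficient n ⟨
        (M-d *ₛ (Q +ₛ const 1#)) n ∎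
        where
        x : Carrier
        x = -4# ^ n

      2*1/2≈1 : fromℕ 2 * 1/2 ≈ 1#
      2*1/2≈1 = x*[y/x]≈y (charZero 1)

      scale-N-D : scale -4# N-D ≈ₛ fromℕ 2 ·ₛ N-d
      scale-N-D .coefficient n = begin
        x * (const (fromℕ 2 * (q - 1#)) n + k * log1+ t n)
          ≈⟨ distribˡ _ _ _ ⟩
        x * const (fromℕ 2 * (q - 1#)) n + x * (k * log1+ t n)
          ≈⟨ +-cong (trans (scale-const -4# _ n) (const-* n))
               (*-congˡ (*-congˡ (log1+t≈logarithmic .coefficient n))) ⟩
        fromℕ 2 * const (q - 1#) n + x * (k * logarithmic n)
          -- The factor 1 is created in order to become 2 · 1/2: the 2 goes outside, the 1/2 is the
          -- one before the logarithm in `N-d`.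
          ≈⟨ +-congˡ (solve 3 (λ x k l → x :* (k :* l) := con 1 :* (k :* (x :* l))) refl
               x k (logarithmic n)) ⟩
        fromℕ 2 * const (q - 1#) n + 1# * (k * (x * logarithmic n))
          ≈⟨ +-congˡ (*-cong (sym 2*1/2≈1) (*-congˡ (sym (log1+-4t≈scale .coefficient n)))) ⟩
        fromℕ 2 * const (q - 1#) n + fromℕ 2 * 1/2 * (k * log1+ -4t n)
          ≈⟨ solve 5 (λ t c h k l → t :* c :+ t :* h :* (k :* l) := t :* (c :+ k :* h :* l)) refl
               (fromℕ 2) _ 1/2 k _ ⟩
        fromℕ 2 * (const (q - 1#) n + k * 1/2 * log1+ -4t n) ∎
        where
        x : Carrier
        x = -4# ^ n
        const-* : ∀ {a b} n → const (a * b) n ≈ a * const b n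
        const-* zero    = refl
        const-* (suc n) = sym (zeroʳ _)

      d*M-d≈N-d : d q logq *ₛ M-d ≈ₛ N-d
      d*M-d≈N-d = /ₛ-*ₛ N-d M-d M-d₀≉0

      -- Proved after multiplication by `M-d`, which clears both quotients: each side becomes 2
      -- `N-d`. Cancelling is allowed since the constant term of `M-d` is q - 1.
      2d≈[Q+1]*scale-F : fromℕ 2 ·ₛ d q logq ≈ₛ (Q +ₛ const 1#) *ₛ scale -4# F
      2d≈[Q+1]*scale-F = *ₛ-cancelʳ M-d M-d₀≉0 (R.begin
        (fromℕ 2 ·ₛ d q logq) *ₛ M-d
          R.≈⟨ coefficients (·ₛ-*ₛ (fromℕ 2) (d q logq) M-d) ⟩
        fromℕ 2 ·ₛ (d q logq *ₛ M-d)
          R.≈⟨ coefficients (λ n → *-congˡ (d*M-d≈N-d .coefficient n)) ⟩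
        fromℕ 2 ·ₛ N-d
          R.≈⟨ scale-N-D ⟨
        scale -4# N-D
          R.≈⟨ scale-cong -4# (/ₛ-*ₛ N-D M-D M-D₀≉0) ⟨
        scale -4# (F *ₛ M-D)
          R.≈⟨ scale-*ₛ -4# F M-D ⟩
        scale -4# F *ₛ scale -4# M-D
          R.≈⟨ *ₛ-cong (Sₛ.refl {scale -4# F}) scale-M-D ⟩
        scale -4# F *ₛ (M-d *ₛ (Q +ₛ const 1#))
          R.≈⟨ x∙yz≈zx∙y (scale -4# F) M-d (Q +ₛ const 1#) ⟩
        (Q +ₛ const 1#) *ₛ scale -4# F *ₛ M-d R.∎)
        where
        module R = ≈ₛ-Reasoning
        open CommutativeSemigroupProperties Sₛ.*-commutativeSemigroup using (x∙yz≈zx∙y)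

      scale-F≈D : ∀ n → -4# ^ n / fromℕ (n !) * D q logq n ≈ scale -4# F n
      scale-F≈D n = begin
        -4# ^ n * (fromℕ (n !)) ⁻¹ * (fromℕ (n !) * F n)
          ≈⟨ solve 4 (λ x f f′ y → x :* f′ :* (f :* y) := x :* (f :* f′) :* y) refl
               (-4# ^ n) (fromℕ (n !)) ((fromℕ (n !)) ⁻¹) (F n) ⟩
        -4# ^ n * (fromℕ (n !) * (fromℕ (n !)) ⁻¹) * F n
          ≈⟨ *-congʳ (*-congˡ (inverseʳ (fromℕ≉0 (n !) {{n ℕ.!≢0}}))) ⟩
        -4# ^ n * 1# * F n
          ≈⟨ *-congʳ (*-identityʳ _) ⟩
        -4# ^ n * F n ∎

      tail[Q+1] : tail (Q +ₛ const 1#) ≈ₛ (q * -2#) ·ₛ catalan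
      tail[Q+1] .coefficient m = begin
        q * √1+ -4t (suc m) + 0#  ≈⟨ +-identityʳ _ ⟩
        q * √1+ -4t (suc m)       ≈⟨ *-congˡ (√-catalan m) ⟩
        q * (-2# * catalan m)     ≈⟨ *-assoc _ _ _ ⟨
        q * -2# * catalan m       ∎

      [2]≈q+1 : [ 2 ]⟨ q ⟩ ≈ q + 1#
      [2]≈q+1 = *-cancelˡ q-1≉0 (begin
        (q - 1#) * ((1# - q ^ 2) / (1# - q))
          ≈⟨ solve 3 (λ x y z → x :* (y :* z) := y :* (x :* z)) refl
               (q - 1#) (1# - q ^ 2) ((1# - q) ⁻¹) ⟩
        (1# - q ^ 2) * ((q - 1#) * (1# - q) ⁻¹)
          ≈⟨ *-cong (sym (⁻¹-anti-homo‿- (q ^ 2) 1#)) (*-congʳ (sym (⁻¹-anti-homo‿- 1# q))) ⟩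
        - (q ^ 2 - 1#) * (- (1# - q) * (1# - q) ⁻¹)
          ≈⟨ *-congˡ (-‿distribˡ-* (1# - q) ((1# - q) ⁻¹)) ⟨
        - (q ^ 2 - 1#) * - ((1# - q) * (1# - q) ⁻¹)
          ≈⟨ *-congˡ (-‿cong (inverseʳ 1-q≉0)) ⟩
        - (q ^ 2 - 1#) * - 1#
          ≈⟨ trans (sym (-‿distribˡ-* _ _))
               (-‿cong (trans (sym (-‿distribʳ-* _ _)) (-‿cong (*-identityʳ _)))) ⟩
        - - (q ^ 2 - 1#)
          ≈⟨ -‿involutive _ ⟩
        q ^ 2 - 1#
          ≈⟨ [q-1][q+1]≈q²-1 ⟨
        (q - 1#) * (q + 1#) ∎)
        where
        1-q≉0 : ¬ (1# - q ≈ 0#)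
        1-q≉0 1-q≈0 = q-1≉0 (trans (sym (⁻¹-anti-homo‿- 1# q)) (trans (-‿cong 1-q≈0) -0#≈0#))

    -- The logarithm has no constant term, so numerator and denominator both start with q - 1.
    d₀≈1 : d q logq 0 ≈ 1#
    d₀≈1 = *-cancelˡ M-d₀≉0 (begin
      M-d 0 * d q logq 0                        ≈⟨ *-comm _ _ ⟩
      d q logq 0 * M-d 0                        ≈⟨ +-identityʳ _ ⟨
      d q logq 0 * M-d 0 + 0#                   ≈⟨ d*M-d≈N-d .coefficient 0 ⟩
      q - 1# + k * 1/2 * log1+ -4t 0            ≈⟨ +-congˡ (*-congˡ (log1+-4t≈scale .coefficient 0)) ⟩
      q - 1# + k * 1/2 * (1# * 0#)              ≈⟨ +-congˡ (trans (*-congˡ (zeroʳ 1#)) (zeroʳ _)) ⟩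
      q - 1# + 0#                               ≈⟨ +-identityʳ _ ⟩
      q - 1#                                    ≈⟨ M-d₀≈q-1 ⟨
      M-d 0                                     ≈⟨ *-identityʳ _ ⟨
      M-d 0 * 1#                                ∎)

    d-suc : ∀ n → d q logq (suc n) ≈
      [ 2 ]⟨ q ⟩ / fromℕ 2 * (-4# ^ suc n / fromℕ (suc n !)) * D q logq (suc n)
      - q * ∑< (suc n) (λ m → -4# ^ (suc n ∸ m ∸ 1) / fromℕ ((suc n ∸ m ∸ 1) !)
                               * D q logq (suc n ∸ m ∸ 1) * catalan m)
    d-suc n = *-cancelˡ (charZero 1) (begin
      fromℕ 2 * d q logq (suc n)
        ≈⟨ 2d≈[Q+1]*scale-F .coefficient (suc n) ⟩
      (Q 0 + 1#) * G (suc n) + (tail (Q +ₛ const 1#) *ₛ G) n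
        -- The constant term q + 1 of `Q +ₛ const 1#` is the source of [2]_q; its higher
        -- coefficients are -2q times the Catalan numbers and produce the convolution.
        ≈⟨ +-cong (*-congʳ (trans (+-congʳ (trans (*-congˡ √₀≈1) (*-identityʳ q))) (sym [2]≈q+1)))
             (trans (*ₛ-cong tail[Q+1] (Sₛ.refl {G}) .coefficient n) (·ₛ-*ₛ (q * -2#) catalan G n)) ⟩
      [ 2 ]⟨ q ⟩ * G (suc n) + q * -2# * (catalan *ₛ G) n
        ≈⟨ +-cong (*-congˡ (scale-F≈D (suc n))) (*-congˡ (sum-cong-≋ {suc n} (λ i → terms (toℕ i)))) ⟨
      [ 2 ]⟨ q ⟩ * (X * D q logq (suc n)) + q * -2# * Σ
        ≈⟨ +-cong (trans (*-congʳ (sym (x*[y/x]≈y (charZero 1))))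
             (solve 4 (λ t z x y → t :* z :* (x :* y) := t :* (z :* x :* y)) refl
               (fromℕ 2) ([ 2 ]⟨ q ⟩ / fromℕ 2) X (D q logq (suc n)))) q*-2*Σ ⟩
      fromℕ 2 * ([ 2 ]⟨ q ⟩ / fromℕ 2 * X * D q logq (suc n)) + fromℕ 2 * - (q * Σ)
        ≈⟨ distribˡ _ _ _ ⟨
      fromℕ 2 * ([ 2 ]⟨ q ⟩ / fromℕ 2 * X * D q logq (suc n) - q * Σ) ∎)
      where
      G : Series
      G = scale -4# F
      term : ℕ → Carrier
      term m = -4# ^ (suc n ∸ m ∸ 1) / fromℕ ((suc n ∸ m ∸ 1) !)
               * D q logq (suc n ∸ m ∸ 1) * catalan m
      X Σ : Carrier
      X = -4# ^ suc n / fromℕ (suc n !)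
      Σ = ∑< (suc n) term

      terms : ∀ m → term m ≈ catalan m * G (n ∸ m)
      terms m = begin
        term m                            ≈⟨ *-congʳ (scale-F≈D (suc n ∸ m ∸ 1)) ⟩
        G (suc n ∸ m ∸ 1) * catalan m     ≈⟨ *-comm _ _ ⟩
        catalan m * G (suc n ∸ m ∸ 1)     ≡⟨ ≡.cong (λ j → catalan m * G j) (ℕ.pred[m∸n]≡m∸[1+n] (suc n) m) ⟩
        catalan m * G (n ∸ m)             ∎

      q*-2*Σ : q * -2# * Σ ≈ fromℕ 2 * - (q * Σ)
      q*-2*Σ = begin
        q * - fromℕ 2 * Σ       ≈⟨ solve 3 (λ q y s → q :* y :* s := y :* (q :* s)) refl q -2# Σ ⟩
        - fromℕ 2 * (q * Σ)     ≈⟨ -‿distribˡ-* _ _ ⟨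
        - (fromℕ 2 * (q * Σ))   ≈⟨ -‿distribʳ-* _ _ ⟩
        fromℕ 2 * - (q * Σ)     ∎

theorem1 : ∀ {c ℓ} {p : ℕ} (pp : Prime p) → ¬ (2 ∣ p) →
    (ℂₚ : ComplexPadic p c ℓ) →
    let open ComplexPadic ℂₚ
        open CatalanDaehee ℂₚ in
    (q : Carrier) → ∣ 1# - q ∣<p^- 1/[ pp -1] → ¬ (q ≈ 1#) →
    (logq : Carrier) → IsLog q logq →
    (d q logq 0 ≈ 1#) ×
    (∀ n → 1 ℕ.≤ n →
      d q logq n ≈
        [ 2 ]⟨ q ⟩ / fromℕ 2 * ((- fromℕ 4) ^ n / fromℕ (n !)) * D q logq n
        - q * ∑< n (λ m →
            (- fromℕ 4) ^ (n ∸ m ∸ 1) / fromℕ ((n ∸ m ∸ 1) !)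
            * D q logq (n ∸ m ∸ 1) * catalan m))
theorem1 pp 2∤p ℂₚ q small q≉1 logq _ =
  d₀≈1 q logq q-1≉0 q+1≉0 , λ where (suc n) _ → d-suc q logq q-1≉0 q+1≉0 n
  where
  open ComplexPadic ℂₚ
  open CatalanDaeheeProperties ℂₚ
  q-1≉0 : ¬ (q - 1# ≈ 0#)
  q-1≉0 q-1≈0 = q≉1 (GroupProperties.x∙y⁻¹≈ε⇒x≈y +-group q 1# q-1≈0)
  q+1≉0 : ¬ (q + 1# ≈ 0#)
  q+1≉0 = Valuation.1+q≉0 ℂₚ 2∤p (0<1/[p-1] pp) small
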